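{- The focused sequent calculus with tag annotations is sound and complete with respect to the sequent calculus: for every stoup $S$, context $\Gamma$ and formula $A$, the sequent $S\mid\Gamma\vdash A$ is derivable in the sequent calculus if and only if the untagged sequent $S\mid\Gamma\vdash_{\mathsf{RI}}A$ is derivable in the focused sequent calculus with tag annotations.
   Context: Fix a set $\mathsf{At}$ of atomic formulae. Formulae are generated by $A,B ::= X \mid \mathsf{I} \mid A\otimes B \mid A\wedge B \mid A\vee B$ with $X\in\mathsf{At}$. A stoup $S$ is either empty (written $-$) or a single formula. A context $\Gamma$ is a finite ordered list of formulae (possibly empty); a comma denotes concatenation. A sequent is a triple $S\mid\Gamma\vdash A$ with $S$ a stoup, $\Gamma$ a context and $A$ a formula. Sequent calculus. Derivations are inductively generated by the following rules (premises $\Rightarrow$ conclusion): - $\mathsf{ax}$: (no premise) $\Rightarrow A\mid\;\vdash A$ (empty context), for any formula $A$; - $\mathsf{pass}$: $A\mid\Gamma\vdash C \Rightarrow { - }\mid A,\Gamma\vdash C$; - $\mathsf{IL}$: ${ - }\mid\Gamma\vdash C \Rightarrow \mathsf{I}\mid\Gamma\vdash C$; - $\mathsf{IR}$: (no premise) $\Rightarrow { - }\mid\;\vdash\mathsf{I}$; - $\otimes\mathsf{L}$: $A\mid B,\Gamma\vdash C \Rightarrow A\otimes B\mid\Gamma\vdash C$; - $\otimes\mathsf{R}$: $S\mid\Gamma\vdash A$ and ${ - }\mid\Delta\vdash B \Rightarrow S\mid\Gamma,\Delta\vdash A\otimes B$; - $\wedge\mathsf{L}_1$: $A\mid\Gamma\vdash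 C\Rightarrow A\wedge B\mid\Gamma\vdash C$; $\wedge\mathsf{L}_2$: $B\mid\Gamma\vdash C\Rightarrow A\wedge B\mid\Gamma\vdash C$; - $\wedge\mathsf{R}$: $S\mid\Gamma\vdash A$ and $S\mid\Gamma\vdash B\Rightarrow S\mid\Gamma\vdash A\wedge B$; - $\vee\mathsf{L}$: $A\mid\Gamma\vdash C$ and $B\mid\Gamma\vdash C\Rightarrow A\vee B\mid\Gamma\vdash C$; - $\vee\mathsf{R}_1$: $S\mid\Gamma\vdash A\Rightarrow S\mid\Gamma\vdash A\vee B$; $\vee\mathsf{R}_2$: $S\mid\Gamma\vdash B\Rightarrow S\mid\Gamma\vdash A\vee B$. Focused sequent calculus with tag annotations. A formula is non-negative if its principal connective is not $\wedge$; $P$ always denotes a non-negative formula. A stoup is irreducible if it is empty, an atom, or a formula with principal connective $\wedge$ (i.e. it is not $\mathsf{I}$ and its principal connective is neither $\otimes$ nor $\vee$); $T$ always denotes an irreducible stoup. There are four tags $\mathbb{P},\mathbb{C}_1,\mathbb{C}_2,\mathbb{R}$. A list of tags $l$ is valid if it is non-empty and either $\mathbb{R}\in l$, or both $\mathbb{C}_1\in l$ and $\mathbb{C}_2\in l$. Sequents come in three phases $\vdash_{\mathsf{RI}},\vdash_{\mathsf{LI}},\vdash_{\mathsf{F}}$; an $\mathsf{RI}$-sequent is either untagged or carries a list of tags $l$ (written $\vdash^l_{\mathsf{RI}}$), and an $\mathsf{LI}$- or $\mathsf{F}$-sequent is either untagged or carries a single tag $t$ (written $\vdash^t_{\mathsf{LI}}$,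 $\vdash^t_{\mathsf{F}}$). A question mark, as in $l?$ or $t?$, means that the rule exists both in a version where the annotated sequents are all untagged and in a version where they all carry the indicated tags. A single tag $t$ on an $\mathsf{RI}$-sequent means the singleton list $[t]$. Rules: - $\wedge\mathsf{R}$: $S\mid\Gamma\vdash^{l_1?}_{\mathsf{RI}}A$ and $S\mid\Gamma\vdash^{l_2?}_{\mathsf{RI}}B\Rightarrow S\mid\Gamma\vdash^{l_1?,l_2?}_{\mathsf{RI}}A\wedge B$ (tagged version: the conclusion carries the concatenation $l_1,l_2$); - $\mathsf{LI2RI}$: $S\mid\Gamma\vdash^{t?}_{\mathsf{LI}}P\Rightarrow S\mid\Gamma\vdash^{t?}_{\mathsf{RI}}P$; - $\mathsf{IL}$: ${ - }\mid\Gamma\vdash_{\mathsf{LI}}P\Rightarrow\mathsf{I}\mid\Gamma\vdash_{\mathsf{LI}}P$; - $\otimes\mathsf{L}$: $A\mid B,\Gamma\vdash_{\mathsf{LI}}P\Rightarrow A\otimes B\mid\Gamma\vdash_{\mathsf{LI}}P$; - $\vee\mathsf{L}$: $A\mid\Gamma\vdash_{\mathsf{LI}}P$ and $B\mid\Gamma\vdash_{\mathsf{LI}}P\Rightarrow A\vee B\mid\Gamma\vdash_{\mathsf{LI}}P$; - $\mathsf{F2LI}$: $T\mid\Gamma\vdash^{t?}_{\mathsf{F}}P\Rightarrow T\mid\Gamma\vdash^{t?}_{\mathsf{LI}}P$; - $\mathsf{pass}$: $A\mid\Gamma\vdash_{\mathsf{LI}}P\Rightarrow{ - }\mid A,\Gamma\vdash^{\mathbb{P}?}_{\mathsf{F}}P$;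 - $\mathsf{ax}$: (no premise) $\Rightarrow X\mid\;\vdash^{\mathbb{R}?}_{\mathsf{F}}X$ for $X$ atomic; $\mathsf{IR}$: (no premise) $\Rightarrow{ - }\mid\;\vdash^{\mathbb{R}?}_{\mathsf{F}}\mathsf{I}$; - $\otimes\mathsf{R}$: $T\mid\Gamma\vdash^{l}_{\mathsf{RI}}A$ and ${ - }\mid\Delta\vdash_{\mathsf{RI}}B$, with $l$ valid, $\Rightarrow T\mid\Gamma,\Delta\vdash^{\mathbb{R}?}_{\mathsf{F}}A\otimes B$; - $\vee\mathsf{R}_1$: $T\mid\Gamma\vdash^{l}_{\mathsf{RI}}A$, with $l$ valid, $\Rightarrow T\mid\Gamma\vdash^{\mathbb{R}?}_{\mathsf{F}}A\vee B$; $\vee\mathsf{R}_2$: $T\mid\Gamma\vdash^{l}_{\mathsf{RI}}B$, with $l$ valid, $\Rightarrow T\mid\Gamma\vdash^{\mathbb{R}?}_{\mathsf{F}}A\vee B$; - $\wedge\mathsf{L}_1$: $A\mid\Gamma\vdash_{\mathsf{LI}}P\Rightarrow A\wedge B\mid\Gamma\vdash^{\mathbb{C}_1?}_{\mathsf{F}}P$; $\wedge\mathsf{L}_2$: $B\mid\Gamma\vdash_{\mathsf{LI}}P\Rightarrow A\wedge B\mid\Gamma\vdash^{\mathbb{C}_2?}_{\mathsf{F}}P$. -}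

module Defs where

open import Data.List.Base using (List; []; _∷_; [_]; _++_)
open import Data.List.Membership.Propositional using (_∈_)
open import Data.Maybe.Base using (Maybe; just; nothing)
open import Data.Product.Base using (_×_)
open import Data.Sum.Base using (_⊎_)
open import Level using (Level)
open import Relation.Binary.PropositionalEquality.Core using (_≢_)

infixr 30 _⊗_ _∧_ _∨_

data Formula {a : Level} (At : Set a) : Set a where
  at  : At → Formula At
  I   : Formula At
  _⊗_ : Formula At → Formula At → Formula At
  _∧_ : Formula At → Formula At → Formula At
  _∨_ : Formula At → Formula At → Formula At

-- The empty stoup is `nothing`.
Stoup : {a : Level} → Set a → Set a
Stoup At = Maybe (Formula At)

Context : {a : Level} → Set a → Set a
Context At = List (Formula At)

private
  variable
    a : Level
    At : Set a
    X : At
    A B C P : Formula At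
    S T : Stoup At
    Γ Δ : Context At

infix 4 _∣_⊢_

data _∣_⊢_ {a : Level} {At : Set a} : Stoup At → Context At → Formula At → Set a where
  ax   : just A ∣ [] ⊢ A
  pass : just A ∣ Γ ⊢ C → nothing ∣ A ∷ Γ ⊢ C
  IL   : nothing ∣ Γ ⊢ C → just I ∣ Γ ⊢ C
  IR   : nothing ∣ [] ⊢ I
  ⊗L   : just A ∣ B ∷ Γ ⊢ C → just (A ⊗ B) ∣ Γ ⊢ C
  ⊗R   : S ∣ Γ ⊢ A → nothing ∣ Δ ⊢ B → S ∣ Γ ++ Δ ⊢ A ⊗ B
  ∧L₁  : just A ∣ Γ ⊢ C → just (A ∧ B) ∣ Γ ⊢ C
  ∧L₂  : just B ∣ Γ ⊢ C → just (A ∧ B) ∣ Γ ⊢ C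
  ∧R   : S ∣ Γ ⊢ A → S ∣ Γ ⊢ B → S ∣ Γ ⊢ A ∧ B
  ∨L   : just A ∣ Γ ⊢ C → just B ∣ Γ ⊢ C → just (A ∨ B) ∣ Γ ⊢ C
  ∨R₁  : S ∣ Γ ⊢ A → S ∣ Γ ⊢ A ∨ B
  ∨R₂  : S ∣ Γ ⊢ B → S ∣ Γ ⊢ A ∨ B

data NonNegative {a : Level} {At : Set a} : Formula At → Set a where
  atⁿ : NonNegative (at X)
  Iⁿ  : NonNegative I
  ⊗ⁿ  : NonNegative (A ⊗ B)
  ∨ⁿ  : NonNegative (A ∨ B)

data Irreducible {a : Level} {At : Set a} : Stoup At → Set a where
  -ⁱ  : Irreducible nothing
  atⁱ : Irreducible (just (at X))
  ∧ⁱ  : Irreducible (just (A ∧ B))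

data Tag : Set where
  ℙ ℂ₁ ℂ₂ ℝ : Tag

private
  variable
    t : Tag
    l l₁ l₂ : List Tag
    t? : Maybe Tag

Valid : List Tag → Set
Valid l = l ≢ [] × (ℝ ∈ l ⊎ (ℂ₁ ∈ l × ℂ₂ ∈ l))

-- `Optional t t?` says that the annotation `t?` is either absent or exactly `t`.
data Optional (t : Tag) : Maybe Tag → Set where
  untagged : Optional t nothing
  tagged   : Optional t (just t)

infix 4 _∣_⊢RI[_]_ _∣_⊢LI[_]_ _∣_⊢F[_]_

-- The bracketed index is the tag annotation; `nothing` is an untagged sequent,
-- which differs from one carrying the empty list, `just []`.
mutual

  data _∣_⊢RI[_]_ {a : Level} {At : Set a} :
       Stoup At → Context At → Maybe (List Tag) → Formula At → Set a where
    ∧R      : S ∣ Γ ⊢RI[ nothing ] A → S ∣ Γ ⊢RI[ nothing ] B →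
              S ∣ Γ ⊢RI[ nothing ] A ∧ B
    ∧Rᵗ     : S ∣ Γ ⊢RI[ just l₁ ] A → S ∣ Γ ⊢RI[ just l₂ ] B →
              S ∣ Γ ⊢RI[ just (l₁ ++ l₂) ] A ∧ B
    LI2RI   : NonNegative P → S ∣ Γ ⊢LI[ nothing ] P → S ∣ Γ ⊢RI[ nothing ] P
    LI2RIᵗ  : NonNegative P → S ∣ Γ ⊢LI[ just t ] P → S ∣ Γ ⊢RI[ just [ t ] ] P

  data _∣_⊢LI[_]_ {a : Level} {At : Set a} :
       Stoup At → Context At → Maybe Tag → Formula At → Set a where
    IL   : NonNegative P → nothing ∣ Γ ⊢LI[ nothing ] P → just I ∣ Γ ⊢LI[ nothing ] P
    ⊗L   : NonNegative P → just A ∣ B ∷ Γ ⊢LI[ nothing ] P →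
           just (A ⊗ B) ∣ Γ ⊢LI[ nothing ] P
    ∨L   : NonNegative P → just A ∣ Γ ⊢LI[ nothing ] P → just B ∣ Γ ⊢LI[ nothing ] P →
           just (A ∨ B) ∣ Γ ⊢LI[ nothing ] P
    F2LI : Irreducible T → NonNegative P → T ∣ Γ ⊢F[ t? ] P → T ∣ Γ ⊢LI[ t? ] P

  data _∣_⊢F[_]_ {a : Level} {At : Set a} :
       Stoup At → Context At → Maybe Tag → Formula At → Set a where
    pass : Optional ℙ t? → NonNegative P →
           just A ∣ Γ ⊢LI[ nothing ] P → nothing ∣ A ∷ Γ ⊢F[ t? ] P
    ax   : Optional ℝ t? → just (at X) ∣ [] ⊢F[ t? ] at X
    IR   : Optional ℝ t? → nothing ∣ [] ⊢F[ t? ] I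
    ⊗R   : Optional ℝ t? → Irreducible T → Valid l →
           T ∣ Γ ⊢RI[ just l ] A → nothing ∣ Δ ⊢RI[ nothing ] B →
           T ∣ Γ ++ Δ ⊢F[ t? ] A ⊗ B
    ∨R₁  : Optional ℝ t? → Irreducible T → Valid l →
           T ∣ Γ ⊢RI[ just l ] A → T ∣ Γ ⊢F[ t? ] A ∨ B
    ∨R₂  : Optional ℝ t? → Irreducible T → Valid l →
           T ∣ Γ ⊢RI[ just l ] B → T ∣ Γ ⊢F[ t? ] A ∨ B
    ∧L₁  : Optional ℂ₁ t? → NonNegative P →
           just A ∣ Γ ⊢LI[ nothing ] P → just (A ∧ B) ∣ Γ ⊢F[ t? ] P
    ∧L₂  : Optional ℂ₂ t? → NonNegative P →
           just B ∣ Γ ⊢LI[ nothing ] P → just (A ∧ B) ∣ Γ ⊢F[ t? ] P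

{-# OPTIONS --safe #-}

-- Completeness amounts to admissibility of the unfocused rules in the untagged RI phase.
-- The left rules and pass commute with ∧R, hence apply at the root of an RI derivation.
-- For ⊗R and ∨Rᵢ, first invert the left rules on the stoup of the (first) premise.  Once
-- the stoup is irreducible, the premise is a tree of ∧R over F derivations, and recording
-- their last rules yields a list of tags.  Either this list is valid, and the focused
-- right rule applies, or all leaves end with the same rule among pass, ∧L₁ and ∧L₂; that
-- rule is then moved below the right rule, and the argument continues with the smaller
-- antecedent.
module Submission where

open import Data.List.Base using (List; []; _∷_; [_]; _++_)
open import Data.List.Membership.Propositional using (_∈_)
open import Data.List.Membership.Propositional.Properties using (∈-++⁺ˡ; ∈-++⁺ʳ)
open import Data.List.Relation.Unary.Any using (here)
open import Data.List.Properties using (++-identityʳ)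
open import Data.Maybe.Base using (just; nothing)
open import Data.Product.Base using (∃-syntax; _×_; _,_)
open import Data.Sum.Base using (_⊎_; inj₁; inj₂)
open import Function.Bundles using (_⇔_; mk⇔)
open import Level using (Level)
open import Relation.Binary.PropositionalEquality.Core using (_≢_; refl; sym; subst)
open import Defs

private
  variable
    a : Level
    At : Set a
    A B C P : Formula At
    S T : Stoup At
    Γ Δ : Context At
    l l₁ l₂ : List Tag

mutual

  RI-sound : ∀ {l?} → S ∣ Γ ⊢RI[ l? ] A → S ∣ Γ ⊢ A
  RI-sound (∧R d e)     = ∧R (RI-sound d) (RI-sound e)
  RI-sound (∧Rᵗ d e)    = ∧R (RI-sound d) (RI-sound e)
  RI-sound (LI2RI _ d)  = LI-sound d
  RI-sound (LI2RIᵗ _ d) = LI-sound d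

  LI-sound : ∀ {t?} → S ∣ Γ ⊢LI[ t? ] A → S ∣ Γ ⊢ A
  LI-sound (IL _ d)     = IL (LI-sound d)
  LI-sound (⊗L _ d)     = ⊗L (LI-sound d)
  LI-sound (∨L _ d e)   = ∨L (LI-sound d) (LI-sound e)
  LI-sound (F2LI _ _ d) = F-sound d

  F-sound : ∀ {t?} → S ∣ Γ ⊢F[ t? ] A → S ∣ Γ ⊢ A
  F-sound (pass _ _ d)   = pass (LI-sound d)
  F-sound (ax _)         = ax
  F-sound (IR _)         = IR
  F-sound (⊗R _ _ _ d e) = ⊗R (RI-sound d) (RI-sound e)
  F-sound (∨R₁ _ _ _ d)  = ∨R₁ (RI-sound d)
  F-sound (∨R₂ _ _ _ d)  = ∨R₂ (RI-sound d)
  F-sound (∧L₁ _ _ d)    = ∧L₁ (LI-sound d)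
  F-sound (∧L₂ _ _ d)    = ∧L₂ (LI-sound d)

-- An untagged RI derivation is a tree of `∧R` over LI derivations with non-negative succedents, so
-- a transformation that keeps the succedent acts leaf by leaf.
mapRI : (∀ {P} → NonNegative P → S ∣ Γ ⊢LI[ nothing ] P → T ∣ Δ ⊢LI[ nothing ] P) →
        S ∣ Γ ⊢RI[ nothing ] A → T ∣ Δ ⊢RI[ nothing ] A
mapRI f (∧R d e)    = ∧R (mapRI f d) (mapRI f e)
mapRI f (LI2RI n d) = LI2RI n (f n d)

passRI : just A ∣ Γ ⊢RI[ nothing ] C → nothing ∣ A ∷ Γ ⊢RI[ nothing ] C
passRI = mapRI λ n d → F2LI -ⁱ n (pass untagged n d)

ILRI : nothing ∣ Γ ⊢RI[ nothing ] C → just I ∣ Γ ⊢RI[ nothing ] C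
ILRI = mapRI IL

⊗LRI : just A ∣ B ∷ Γ ⊢RI[ nothing ] C → just (A ⊗ B) ∣ Γ ⊢RI[ nothing ] C
⊗LRI = mapRI ⊗L

∧L₁RI : just A ∣ Γ ⊢RI[ nothing ] C → just (A ∧ B) ∣ Γ ⊢RI[ nothing ] C
∧L₁RI = mapRI λ n d → F2LI ∧ⁱ n (∧L₁ untagged n d)

∧L₂RI : just B ∣ Γ ⊢RI[ nothing ] C → just (A ∧ B) ∣ Γ ⊢RI[ nothing ] C
∧L₂RI = mapRI λ n d → F2LI ∧ⁱ n (∧L₂ untagged n d)

-- `∧R` is forced on a conjunction and impossible on a non-negative formula, so `C` alone fixes the
-- `∧R` tree and the leaves of the two derivations pair up.
∨LRI : just A ∣ Γ ⊢RI[ nothing ] C → just B ∣ Γ ⊢RI[ nothing ] C →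
       just (A ∨ B) ∣ Γ ⊢RI[ nothing ] C
∨LRI (∧R d₁ d₂)   (∧R e₁ e₂)  = ∧R (∨LRI d₁ e₁) (∨LRI d₂ e₂)
∨LRI (LI2RI n d)  (LI2RI _ e) = LI2RI n (∨L n d e)
∨LRI (∧R _ _)     (LI2RI () _)
∨LRI (LI2RI () _) (∧R _ _)

-- `F2LI` demands an irreducible stoup, so here and in the next three inversions the last rule of
-- each leaf is forced and can be stripped.
IL⁻¹ : just I ∣ Γ ⊢RI[ nothing ] C → nothing ∣ Γ ⊢RI[ nothing ] C
IL⁻¹ = mapRI λ { _ (IL _ d) → d ; _ (F2LI () _ _) }

⊗L⁻¹ : just (A ⊗ B) ∣ Γ ⊢RI[ nothing ] C → just A ∣ B ∷ Γ ⊢RI[ nothing ] C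
⊗L⁻¹ = mapRI λ { _ (⊗L _ d) → d ; _ (F2LI () _ _) }

∨L₁⁻¹ : just (A ∨ B) ∣ Γ ⊢RI[ nothing ] C → just A ∣ Γ ⊢RI[ nothing ] C
∨L₁⁻¹ = mapRI λ { _ (∨L _ d _) → d ; _ (F2LI () _ _) }

∨L₂⁻¹ : just (A ∨ B) ∣ Γ ⊢RI[ nothing ] C → just B ∣ Γ ⊢RI[ nothing ] C
∨L₂⁻¹ = mapRI λ { _ (∨L _ _ e) → e ; _ (F2LI () _ _) }

-- The phase is RI, not LI, because `C` may be a conjunction assembled from several leaves.
data Premise {a} {At : Set a} : Tag → Stoup At → Context At → Formula At → Set a where
  passᵖ : just A ∣ Γ ⊢RI[ nothing ] C → Premise ℙ nothing (A ∷ Γ) C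
  ∧L₁ᵖ  : just A ∣ Γ ⊢RI[ nothing ] C → Premise ℂ₁ (just (A ∧ B)) Γ C
  ∧L₂ᵖ  : just B ∣ Γ ⊢RI[ nothing ] C → Premise ℂ₂ (just (A ∧ B)) Γ C

∈⇒≢[] : ∀ {t} → t ∈ l → l ≢ []
∈⇒≢[] () refl

valid-ℝ : ℝ ∈ l → Valid l
valid-ℝ r = ∈⇒≢[] r , inj₁ r

valid-ℂ : ℂ₁ ∈ l → ℂ₂ ∈ l → Valid l
valid-ℂ c₁ c₂ = ∈⇒≢[] c₁ , inj₂ (c₁ , c₂)

valid-++ˡ : Valid l₁ → Valid (l₁ ++ l₂)
valid-++ˡ (_ , inj₁ r)         = valid-ℝ (∈-++⁺ˡ r)
valid-++ˡ (_ , inj₂ (c₁ , c₂)) = valid-ℂ (∈-++⁺ˡ c₁) (∈-++⁺ˡ c₂)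

valid-++ʳ : ∀ l₁ → Valid l₂ → Valid (l₁ ++ l₂)
valid-++ʳ l₁ (_ , inj₁ r)         = valid-ℝ (∈-++⁺ʳ l₁ r)
valid-++ʳ l₁ (_ , inj₂ (c₁ , c₂)) = valid-ℂ (∈-++⁺ʳ l₁ c₁) (∈-++⁺ʳ l₁ c₂)

-- In the second case t ∈ l is kept because uniform ℂ₁ and ℂ₂ branches merge into a valid list.
ValidOrUniform : {At : Set a} → List Tag → Stoup At → Context At → Formula At → Set a
ValidOrUniform l T Γ C = Valid l ⊎ (∃[ t ] t ∈ l × Premise t T Γ C)

tagF : NonNegative P → T ∣ Γ ⊢F[ nothing ] P →
       ∃[ t ] T ∣ Γ ⊢F[ just t ] P × ValidOrUniform [ t ] T Γ P
tagF n (pass _ _ d)   = ℙ , pass tagged n d , inj₂ (ℙ , here refl , passᵖ (LI2RI n d))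
tagF _ (ax _)         = ℝ , ax tagged , inj₁ (valid-ℝ (here refl))
tagF _ (IR _)         = ℝ , IR tagged , inj₁ (valid-ℝ (here refl))
tagF _ (⊗R _ i v d e) = ℝ , ⊗R tagged i v d e , inj₁ (valid-ℝ (here refl))
tagF _ (∨R₁ _ i v d)  = ℝ , ∨R₁ tagged i v d , inj₁ (valid-ℝ (here refl))
tagF _ (∨R₂ _ i v d)  = ℝ , ∨R₂ tagged i v d , inj₁ (valid-ℝ (here refl))
tagF n (∧L₁ _ _ d)    = ℂ₁ , ∧L₁ tagged n d , inj₂ (ℂ₁ , here refl , ∧L₁ᵖ (LI2RI n d))
tagF n (∧L₂ _ _ d)    = ℂ₂ , ∧L₂ tagged n d , inj₂ (ℂ₂ , here refl , ∧L₂ᵖ (LI2RI n d))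

-- The stoup decides between `pass` and `∧L`, so two uniform sides can disagree only as `ℂ₁` against
-- `ℂ₂`, and then both tags occur in the concatenation.
merge : ∀ l₁ → ValidOrUniform l₁ T Γ A → ValidOrUniform l₂ T Γ B →
        ValidOrUniform (l₁ ++ l₂) T Γ (A ∧ B)
merge l₁ (inj₁ v) _        = inj₁ (valid-++ˡ v)
merge l₁ (inj₂ _) (inj₁ v) = inj₁ (valid-++ʳ l₁ v)
merge l₁ (inj₂ (_ , m , passᵖ d)) (inj₂ (_ , _ , passᵖ e)) =
  inj₂ (ℙ , ∈-++⁺ˡ m , passᵖ (∧R d e))
merge l₁ (inj₂ (_ , m , ∧L₁ᵖ d)) (inj₂ (_ , _ , ∧L₁ᵖ e)) =
  inj₂ (ℂ₁ , ∈-++⁺ˡ m , ∧L₁ᵖ (∧R d e))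
merge l₁ (inj₂ (_ , m , ∧L₂ᵖ d)) (inj₂ (_ , _ , ∧L₂ᵖ e)) =
  inj₂ (ℂ₂ , ∈-++⁺ˡ m , ∧L₂ᵖ (∧R d e))
merge l₁ (inj₂ (_ , m₁ , ∧L₁ᵖ _)) (inj₂ (_ , m₂ , ∧L₂ᵖ _)) =
  inj₁ (valid-ℂ (∈-++⁺ˡ m₁) (∈-++⁺ʳ l₁ m₂))
merge l₁ (inj₂ (_ , m₂ , ∧L₂ᵖ _)) (inj₂ (_ , m₁ , ∧L₁ᵖ _)) =
  inj₁ (valid-ℂ (∈-++⁺ʳ l₁ m₁) (∈-++⁺ˡ m₂))

tagRI : Irreducible T → T ∣ Γ ⊢RI[ nothing ] C →
        ∃[ l ] T ∣ Γ ⊢RI[ just l ] C × ValidOrUniform l T Γ C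
tagRI i (∧R d e) =
  let l₁ , d′ , u = tagRI i d
      l₂ , e′ , v = tagRI i e
  in  l₁ ++ l₂ , ∧Rᵗ d′ e′ , merge l₁ u v
tagRI i (LI2RI n (F2LI _ _ d)) =
  let t , d′ , u = tagF n d
  in  [ t ] , LI2RIᵗ n (F2LI i n d′) , u

-- The rule to be permuted below the left rules is abstracted as `right`.
module _ {At : Set a} {A C : Formula At} {Δ : Context At} (n : NonNegative C)
         (right : ∀ {T Γ l} → Irreducible T → Valid l → T ∣ Γ ⊢RI[ just l ] A →
                  T ∣ Γ ++ Δ ⊢F[ nothing ] C) where

  Lifts : Stoup At → Context At → Set a
  Lifts S Γ = S ∣ Γ ⊢RI[ nothing ] A → S ∣ Γ ++ Δ ⊢LI[ nothing ] C

  lift-irreducible : Irreducible T → (∀ {t} → Premise t T Γ A → T ∣ Γ ++ Δ ⊢F[ nothing ] C) →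
                     Lifts T Γ
  lift-irreducible i f d with tagRI i d
  ... | _ , d′ , inj₁ v           = F2LI i n (right i v d′)
  ... | _ , _  , inj₂ (_ , _ , p) = F2LI i n (f p)

  lift-pass : Lifts (just B) Γ → Lifts nothing (B ∷ Γ)
  lift-pass q = lift-irreducible -ⁱ λ { (passᵖ d) → pass untagged n (q d) }

  -- The hypothesis on the empty stoup makes the recursion structural in the stoup formula,
  -- although ⊗L enlarges the context.
  lift-just : ∀ B → Lifts nothing Γ → Lifts (just B) Γ
  -- No `Premise` has an atomic stoup, so the tags are always valid.
  lift-just (at _)  q   = lift-irreducible atⁱ λ ()
  lift-just I       q d = IL n (q (IL⁻¹ d))
  -- Inversion moves `D` to the front of the context; `lift-just D q` followed by `lift-pass`
  -- supplies the empty-stoup hypothesis for `D ∷ Γ`.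
  lift-just (B ⊗ D) q d = ⊗L n (lift-just B (lift-pass (lift-just D q)) (⊗L⁻¹ d))
  lift-just (B ∧ D) q   = lift-irreducible ∧ⁱ λ where
    (∧L₁ᵖ d) → ∧L₁ untagged n (lift-just B q d)
    (∧L₂ᵖ d) → ∧L₂ untagged n (lift-just D q d)
  lift-just (B ∨ D) q d = ∨L n (lift-just B q (∨L₁⁻¹ d)) (lift-just D q (∨L₂⁻¹ d))

  lift-nothing : ∀ Γ → Lifts nothing Γ
  lift-nothing []      = lift-irreducible -ⁱ λ ()
  lift-nothing (B ∷ Γ) = lift-pass (lift-just B (lift-nothing Γ))

  lift : ∀ S Γ → S ∣ Γ ⊢RI[ nothing ] A → S ∣ Γ ++ Δ ⊢RI[ nothing ] C
  lift nothing  Γ d = LI2RI n (lift-nothing Γ d)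
  lift (just B) Γ d = LI2RI n (lift-just B (lift-nothing Γ) d)

⊗RRI : S ∣ Γ ⊢RI[ nothing ] A → nothing ∣ Δ ⊢RI[ nothing ] B →
       S ∣ Γ ++ Δ ⊢RI[ nothing ] A ⊗ B
⊗RRI d e = lift ⊗ⁿ (λ i v d′ → ⊗R untagged i v d′ e) _ _ d

-- The disjunction rules do not split the context, so `Δ` is empty; `Γ ++ []` equals `Γ` only
-- propositionally, hence the transports.
lift-[] : NonNegative C →
          (∀ {T Γ l} → Irreducible T → Valid l → T ∣ Γ ⊢RI[ just l ] A → T ∣ Γ ⊢F[ nothing ] C) →
          S ∣ Γ ⊢RI[ nothing ] A → S ∣ Γ ⊢RI[ nothing ] C
lift-[] {C = C} {S = S} {Γ = Γ} n right d =
  subst (λ Θ → S ∣ Θ ⊢RI[ nothing ] C) (++-identityʳ Γ)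
    (lift n (λ {T} {Θ} i v e →
       subst (λ Θ → T ∣ Θ ⊢F[ nothing ] C) (sym (++-identityʳ Θ)) (right i v e)) S Γ d)

∨R₁RI : S ∣ Γ ⊢RI[ nothing ] A → S ∣ Γ ⊢RI[ nothing ] A ∨ B
∨R₁RI = lift-[] ∨ⁿ (∨R₁ untagged)

∨R₂RI : S ∣ Γ ⊢RI[ nothing ] B → S ∣ Γ ⊢RI[ nothing ] A ∨ B
∨R₂RI = lift-[] ∨ⁿ (∨R₂ untagged)

-- Focused `ax` covers atoms only; compound identities are expanded by induction on `A`.
axRI : (A : Formula At) → just A ∣ [] ⊢RI[ nothing ] A
axRI (at _)  = LI2RI atⁿ (F2LI atⁱ atⁿ (ax untagged))
axRI I       = LI2RI Iⁿ (IL Iⁿ (F2LI -ⁱ Iⁿ (IR untagged)))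
axRI (A ⊗ B) = ⊗LRI (⊗RRI (axRI A) (passRI (axRI B)))
axRI (A ∧ B) = ∧R (∧L₁RI (axRI A)) (∧L₂RI (axRI B))
axRI (A ∨ B) = ∨LRI (∨R₁RI (axRI A)) (∨R₂RI (axRI B))

RI-complete : S ∣ Γ ⊢ A → S ∣ Γ ⊢RI[ nothing ] A
RI-complete ax       = axRI _
RI-complete (pass d) = passRI (RI-complete d)
RI-complete (IL d)   = ILRI (RI-complete d)
RI-complete IR       = LI2RI Iⁿ (F2LI -ⁱ Iⁿ (IR untagged))
RI-complete (⊗L d)   = ⊗LRI (RI-complete d)
RI-complete (⊗R d e) = ⊗RRI (RI-complete d) (RI-complete e)
RI-complete (∧L₁ d)  = ∧L₁RI (RI-complete d)
RI-complete (∧L₂ d)  = ∧L₂RI (RI-complete d)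
RI-complete (∧R d e) = ∧R (RI-complete d) (RI-complete e)
RI-complete (∨L d e) = ∨LRI (RI-complete d) (RI-complete e)
RI-complete (∨R₁ d)  = ∨R₁RI (RI-complete d)
RI-complete (∨R₂ d)  = ∨R₂RI (RI-complete d)

theorem4p1 : {a : Level} (At : Set a) (S : Stoup At) (Γ : Context At) (A : Formula At) →
    (S ∣ Γ ⊢ A) ⇔ (S ∣ Γ ⊢RI[ nothing ] A)
theorem4p1 At S Γ A = mk⇔ RI-complete RI-sound
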